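{- For any small enough constant $\delta > 0$, there exists a family of bipartite $(r,t)$-Ruzsa-Szemer\'{e}di graphs $G=(A,B,E)$ with $|A| = |B| = N$, $r = (\frac{1}{2} - \delta) \cdot N$, and $t = N^{\Omega(\frac{1}{\log \log N})}$, such that there are $N^{\Omega(\frac{1}{\log \log N})}$ disjoint near-perfect matchings in $G$, each of size exactly $(1 - 2\delta) \cdot N$.
   Context: A matching $M$ in a graph $G$ is an induced matching if the edge set of the subgraph of $G$ induced by the vertices covered by $M$ is exactly $M$. A bipartite graph $G=(A,B,E)$ is an $(r,t)$-Ruzsa-Szemer\'{e}di graph if $E$ can be partitioned into $t$ disjoint matchings $M_1,\dots,M_t$ such that for every $i$, $|M_i|\ge r$ and $M_i$ is an induced matching in $G$.
   Formalization: The constant δ is taken to be rational; since matchings of size exactly (1 − 2δ)·N exist only when this number is an integer, irrational δ are not covered. -}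

module Defs where

open import Data.Nat using (ℕ; zero; suc; _+_; _*_; _^_; _≤_; _<_)
open import Data.Nat.Logarithm using (⌊log₂_⌋)
open import Data.Fin using (Fin)
open import Data.Bool using (Bool; true)
open import Data.Product using (Σ; _×_; _,_; proj₁; proj₂)
open import Data.Sum using (_⊎_)
open import Data.Empty using (⊥)
open import Data.List using (List; length)
open import Data.List.Membership.Propositional using (_∈_)
open import Data.List.Relation.Unary.All using (All)
open import Data.List.Relation.Unary.Unique.Propositional using (Unique)
open import Relation.Binary.PropositionalEquality using (_≡_; _≢_)

-- A bipartite graph G = (A, B, E) with A = B = Fin N (two disjoint copies),
-- given by its (decidable) edge relation: E a b ≡ true iff {a,b} ∈ E.
BipGraph : ℕ → Set
BipGraph N = Fin N → Fin N → Bool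

Edge : ℕ → Set
Edge N = Fin N × Fin N

IsEdge : {N : ℕ} → BipGraph N → Edge N → Set
IsEdge E (a , b) = E a b ≡ true

IsMatching : {N : ℕ} → BipGraph N → List (Edge N) → Set
IsMatching {N} E M =
  Unique M × All (IsEdge E) M ×
  ((e e′ : Edge N) → e ∈ M → e′ ∈ M →
     (proj₁ e ≡ proj₁ e′ ⊎ proj₂ e ≡ proj₂ e′) → e ≡ e′)

IsInduced : {N : ℕ} → BipGraph N → List (Edge N) → Set
IsInduced {N} E M =
  (e e′ : Edge N) → e ∈ M → e′ ∈ M →
    E (proj₁ e) (proj₂ e′) ≡ true → (proj₁ e , proj₂ e′) ∈ M

IsRS : {N : ℕ} → BipGraph N → ℕ → ℕ → Set
IsRS {N} E r t =
  Σ (Fin t → List (Edge N)) λ M →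
    ((i : Fin t) → IsMatching E (M i) × IsInduced E (M i) × r ≤ length (M i)) ×
    ((e : Edge N) → IsEdge E e →
       Σ (Fin t) λ i → e ∈ M i × ((j : Fin t) → e ∈ M j → j ≡ i))

loglog : ℕ → ℕ
loglog N = ⌊log₂ ⌊log₂ N ⌋ ⌋

-- x ≥ N^{(cp/cq) / loglog N}, written without real exponents as
-- N^cp ≤ x^(cq · loglog N).
AtLeastPow : ℕ → ℕ → ℕ → ℕ → Set
AtLeastPow cp cq N x = N ^ cp ≤ x ^ (cq * loglog N)

{-# OPTIONS --safe #-}
module Submission where

-- Let L = 2w, let C be a code of words Fin w → Fin Q any two of which agree in
-- fewer than g places, and let the vertices be (z , x) with z ∈ ℤ/L and
-- x ∈ (ℤ/L)^(w × Q).  For c ∈ C the level of (z , x) is z + Σᵢ x(i , c i), and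
-- pushing along d ∈ C adds 1 to every x(i , d i).  So pushing along c raises
-- the c-level by w, while pushing along d ≠ c raises it by less than g.
--
-- The two matchings of c send v to its push along c, for the v with c-level in
-- [0 , w − g) and in [w , 2w − g) respectively.  They exchange these two
-- intervals, which no push along d ≠ c can do; hence both are induced, and
-- their union misses only the fraction g / w of the vertices.  The coordinate
-- z makes the c-level exactly equidistributed.
--
-- Take g / w = 2p / q and Q = 4 ^ q.  The Gilbert–Varshamov argument gives 2 ^ w
-- code words, and log N = (1 + w Q) log (2w), so that
-- w = Ω(log N / log log N) for fixed q.

open import Defs
open import Data.Nat using (ℕ; zero; suc; pred; _+_; _*_; _^_; _∸_; _≤_; _<_; _≤?_; z≤n; s≤s; NonZero; >-nonZero)
open import Data.Nat.Properties
open import Data.Nat.DivMod using (_%_; _mod_; m%n<n; m%n%n≡m%n; m<n⇒m%n≡m; %-distribˡ-+; [m+kn]%n≡m%n)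
open import Data.Nat.Logarithm using (⌊log₂_⌋; ⌊log₂⌋-mono-≤; ⌊log₂[2^n]⌋≡n)
open import Data.Nat.ListAction using (sum)
open import Data.Nat.ListAction.Properties using (sum-++)
open import Data.Nat.Tactic.RingSolver using (solve-∀)
open import Data.Fin using (Fin; zero; suc; toℕ; inject≤; combine; remQuot; finToFun; funToFin)
import Data.Fin.Properties as Fin
open import Data.Bool using (if_then_else_)
open import Data.Product using (Σ; ∃; _×_; _,_; proj₁; proj₂)
import Data.Product.Properties as Product
open import Data.Sum using (_⊎_; inj₁; inj₂)
open import Data.Empty using (⊥)
open import Data.List using (List; []; _∷_; length; map; concat; filter; tabulate)
open import Data.List.Properties using (length-++; length-map; length-tabulate; map-++)
open import Data.List.Membership.Propositional using (_∈_)
open import Data.List.Membership.Propositional.Properties using (∈-tabulate⁺; ∈-tabulate⁻; ∈-filter⁻)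
import Data.List.Membership.DecPropositional as DecMembership
import Data.List.Relation.Unary.All.Properties as All
open import Data.List.Relation.Unary.Any using (here)
import Data.List.Relation.Unary.Unique.Propositional.Properties as Unique
import Data.List.Relation.Binary.Sublist.Propositional.Properties as Sublist
import Data.Vec.Functional as Vector
open import Level using (0ℓ)
open import Relation.Nullary using (Dec; yes; no; ¬_; does; contradiction)
open import Relation.Nullary.Decidable using (¬?; dec-true)
open import Relation.Unary using (Pred; Decidable)
open import Relation.Binary.PropositionalEquality

-- Finite sums

∑ : ∀ {n} → (Fin n → ℕ) → ℕ
∑ {zero}  f = 0
∑ {suc n} f = f zero + ∑ (λ i → f (suc i))

∑-cong : ∀ {n} {f g : Fin n → ℕ} → f ≗ g → ∑ f ≡ ∑ g
∑-cong {zero}  p = refl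
∑-cong {suc n} p = cong₂ _+_ (p zero) (∑-cong (λ i → p (suc i)))

∑-+ : ∀ {n} (f g : Fin n → ℕ) → ∑ (λ i → f i + g i) ≡ ∑ f + ∑ g
∑-+ {zero}  f g = refl
∑-+ {suc n} f g rewrite ∑-+ (λ i → f (suc i)) (λ i → g (suc i)) =
  interchange (f zero) (g zero) _ _
  where
  interchange : ∀ a b c d → (a + b) + (c + d) ≡ (a + c) + (b + d)
  interchange = solve-∀

∑-*ʳ : ∀ {n} (f : Fin n → ℕ) s → ∑ (λ i → f i * s) ≡ ∑ f * s
∑-*ʳ {zero}  f s = refl
∑-*ʳ {suc n} f s rewrite ∑-*ʳ (λ i → f (suc i)) s = sym (*-distribʳ-+ s (f zero) _)

∑-const : ∀ {n} (f : Fin n → ℕ) s → (∀ i → f i ≡ s) → ∑ f ≡ n * s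
∑-const {zero}  f s p = refl
∑-const {suc n} f s p = cong₂ _+_ (p zero) (∑-const _ s (λ i → p (suc i)))

-- Arithmetic modulo L

module Modular (L : ℕ) .{{_ : NonZero L}} where

  %-cong-+ : ∀ {a a′ b b′} → a % L ≡ a′ % L → b % L ≡ b′ % L → (a + b) % L ≡ (a′ + b′) % L
  %-cong-+ {a} {a′} {b} {b′} p q = begin
    (a + b) % L           ≡⟨ %-distribˡ-+ a b L ⟩
    (a % L + b % L) % L   ≡⟨ cong₂ (λ x y → (x + y) % L) p q ⟩
    (a′ % L + b′ % L) % L ≡⟨ %-distribˡ-+ a′ b′ L ⟨
    (a′ + b′) % L         ∎
    where open ≡-Reasoning

  -- s * pred L plays the role of − s.
  %-+-inverse : ∀ a s → (a + (s + s * pred L)) % L ≡ a % L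
  %-+-inverse a s = begin
    (a + (s + s * pred L)) % L ≡⟨ cong (λ x → (a + x) % L) (*-suc s (pred L)) ⟨
    (a + s * suc (pred L)) % L ≡⟨ cong (λ x → (a + s * x) % L) (suc-pred L) ⟩
    (a + s * L) % L            ≡⟨ [m+kn]%n≡m%n a s L ⟩
    a % L                      ∎
    where open ≡-Reasoning

  %-cancelʳ-+ : ∀ a b s → (a + s) % L ≡ (b + s) % L → a % L ≡ b % L
  %-cancelʳ-+ a b s p = begin
    a % L                      ≡⟨ %-+-inverse a s ⟨
    (a + (s + s * pred L)) % L ≡⟨ cong (_% L) (+-assoc a s _) ⟨
    (a + s + s * pred L) % L   ≡⟨ %-cong-+ p refl ⟩
    (b + s + s * pred L) % L   ≡⟨ cong (_% L) (+-assoc b s _) ⟩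
    (b + (s + s * pred L)) % L ≡⟨ %-+-inverse b s ⟩
    b % L                      ∎
    where open ≡-Reasoning

  ∑-cong-% : ∀ {n} (f g : Fin n → ℕ) → (∀ i → f i % L ≡ g i % L) → ∑ f % L ≡ ∑ g % L
  ∑-cong-% {zero}  f g p = refl
  ∑-cong-% {suc n} f g p = %-cong-+ {a = f zero} (p zero) (∑-cong-% _ _ (λ i → p (suc i)))

  toℕ-mod : ∀ a → toℕ (a mod L) ≡ a % L
  toℕ-mod a = Fin.toℕ-fromℕ< (m%n<n a L)

  toℕ-mod-% : ∀ a → toℕ (a mod L) % L ≡ a % L
  toℕ-mod-% a = trans (cong (_% L) (toℕ-mod a)) (m%n%n≡m%n a L)

  toℕ-% : (a : Fin L) → toℕ a % L ≡ toℕ a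
  toℕ-% a = m<n⇒m%n≡m (Fin.toℕ<n a)

  bump : ℕ → Fin L → Fin L
  bump k a = (toℕ a + k) mod L

  bump-injective : ∀ k {a b} → bump k a ≡ bump k b → a ≡ b
  bump-injective k {a} {b} p = Fin.toℕ-injective (begin
    toℕ a     ≡⟨ toℕ-% a ⟨
    toℕ a % L ≡⟨ %-cancelʳ-+ (toℕ a) (toℕ b) k a+k≡b+k ⟩
    toℕ b % L ≡⟨ toℕ-% b ⟩
    toℕ b     ∎)
    where
    open ≡-Reasoning
    a+k≡b+k : (toℕ a + k) % L ≡ (toℕ b + k) % L
    a+k≡b+k = trans (sym (toℕ-mod (toℕ a + k))) (trans (cong toℕ p) (toℕ-mod (toℕ b + k)))

-- Codes of functions and pairs

funToFin-cong : ∀ {m n} {f g : Fin m → Fin n} → f ≗ g → funToFin f ≡ funToFin g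
funToFin-cong {zero}  p = refl
funToFin-cong {suc m} p = cong₂ combine (p zero) (funToFin-cong (λ i → p (suc i)))

remQuot-injective : ∀ {m} n {i j : Fin (m * n)} → remQuot {m} n i ≡ remQuot n j → i ≡ j
remQuot-injective {m} n {i} {j} p = begin
  i                                            ≡⟨ Fin.combine-remQuot {m} n i ⟨
  combine (proj₁ (remQuot {m} n i)) (proj₂ (remQuot {m} n i)) ≡⟨ cong (λ v → combine (proj₁ v) (proj₂ v)) p ⟩
  combine (proj₁ (remQuot {m} n j)) (proj₂ (remQuot {m} n j)) ≡⟨ Fin.combine-remQuot {m} n j ⟩
  j                                            ∎
  where open ≡-Reasoning

-- Words

-- Number-valued, because it is summed in `agree`, serves as an exponent in the weights and is the
-- amount added to a coordinate by a push.
match : ∀ {Q} → Fin Q → Fin Q → ℕ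
match a b = if does (a Fin.≟ b) then 1 else 0

match-refl : ∀ {Q} (a : Fin Q) → match a a ≡ 1
match-refl a = cong (if_then 1 else 0) (dec-true (a Fin.≟ a) refl)

match-sym : ∀ {Q} (a b : Fin Q) → match a b ≡ match b a
match-sym a b with a Fin.≟ b | b Fin.≟ a
... | yes _ | yes _ = refl
... | no  _ | no  _ = refl
... | yes p | no ¬q = contradiction (sym p) ¬q
... | no ¬p | yes q = contradiction (sym q) ¬p

Word : ℕ → ℕ → Set
Word Q w = Fin w → Fin Q

agree : ∀ {Q w} → Word Q w → Word Q w → ℕ
agree c d = ∑ (λ i → match (c i) (d i))

agree-refl : ∀ {Q w} (c : Word Q w) → agree c c ≡ w
agree-refl {w = w} c = trans (∑-const _ 1 (λ i → match-refl (c i))) (*-identityʳ w)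

agree-sym : ∀ {Q w} (c d : Word Q w) → agree c d ≡ agree d c
agree-sym c d = ∑-cong (λ i → match-sym (c i) (d i))

-- The Gilbert–Varshamov argument

length-filter-∁ : ∀ {A : Set} {P : Pred A 0ℓ} (P? : Decidable P) xs →
                  length (filter P? xs) + length (filter (λ x → ¬? (P? x)) xs) ≡ length xs
length-filter-∁ P? []       = refl
length-filter-∁ P? (x ∷ xs) with P? x
... | yes _ = cong suc (length-filter-∁ P? xs)
... | no  _ = trans (+-suc _ _) (cong suc (length-filter-∁ P? xs))

module _ {Q w : ℕ} (g : ℕ) where

  near? : (c x : Word Q w) → Dec (g ≤ agree c x)
  near? c x = g ≤? agree c x

  far? : (c x : Word Q w) → Dec (¬ g ≤ agree c x)
  far? c x = ¬? (near? c x)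

  -- Take the first word `c` of the list, discard every word near it, and recurse on the rest. At
  -- most `B` words are lost each time, so the list lasts for `K` rounds. Membership in `xs` is
  -- carried along because it is what makes the later words far from `c`.
  greedy-code : ∀ B → 0 < B → ∀ K (xs : List (Word Q w)) → K * B ≤ length xs →
                (∀ c → length (filter (near? c) xs) ≤ B) →
                Σ (Fin K → Word Q w) λ f → (∀ i → f i ∈ xs) ×
                  (∀ i j → i ≢ j → agree (f i) (f j) < g)
  greedy-code B B>0 zero    xs       _  _     = (λ ()) , (λ ()) , (λ ())
  greedy-code B B>0 (suc K) []       le _     =
    contradiction (≤-trans (≤-trans B>0 (m≤m+n B (K * B))) le) λ ()
  greedy-code B B>0 (suc K) xs@(c ∷ _) le balls
    with f , f∈ , apart ← greedy-code B B>0 K (filter (far? c) xs)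
           -- The near words number at most `B` out of at least `B + K * B`, so at least `K * B` far
           -- words remain.
           (+-cancelˡ-≤ B _ _ (≤-trans le
             (≤-trans (≤-reflexive (sym (length-filter-∁ (near? c) xs)))
                      (+-monoˡ-≤ _ (balls c)))))
           (λ d → ≤-trans
             -- Balls only shrink when the list is replaced by a sublist.
             (Sublist.length-mono-≤
               (Sublist.filter⁺ (near? d) (near? d) (λ { refl r → r }) (Sublist.filter-⊆ (far? c) xs)))
             (balls d))
    = f′ , f′∈ , apart′
    where
    f′ : Fin (suc K) → Word Q w
    f′ zero    = c
    f′ (suc i) = f i
    f′∈ : ∀ i → f′ i ∈ xs
    f′∈ zero    = here refl
    f′∈ (suc i) = proj₁ (∈-filter⁻ (far? c) (f∈ i))
    c-apart : ∀ i → agree c (f i) < g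
    c-apart i = ≰⇒> (proj₂ (∈-filter⁻ (far? c) {xs = xs} (f∈ i)))
    apart′ : ∀ i j → i ≢ j → agree (f′ i) (f′ j) < g
    apart′ zero    zero    ne = contradiction refl ne
    apart′ zero    (suc j) _  = c-apart j
    apart′ (suc i) zero    _  = subst (_< g) (agree-sym c (f i)) (c-apart i)
    apart′ (suc i) (suc j) ne = apart i j (λ p → ne (cong suc p))

words : ∀ Q w → List (Word Q w)
words Q zero    = (λ ()) ∷ []
words Q (suc w) = concat (tabulate λ b → map (b Vector.∷_) (words Q w))

sum-map-concat-tabulate : ∀ {A : Set} (h : A → ℕ) {n} (F : Fin n → List A) →
                          sum (map h (concat (tabulate F))) ≡ ∑ (λ b → sum (map h (F b)))
sum-map-concat-tabulate h {zero}  F = refl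
sum-map-concat-tabulate h {suc n} F
  rewrite map-++ h (F zero) (concat (tabulate (λ i → F (suc i))))
        | sum-++ (map h (F zero)) (map h (concat (tabulate (λ i → F (suc i)))))
        = cong (sum (map h (F zero)) +_) (sum-map-concat-tabulate h (λ i → F (suc i)))

length-concat-tabulate : ∀ {A : Set} {n} (F : Fin n → List A) →
                         length (concat (tabulate F)) ≡ ∑ (λ b → length (F b))
length-concat-tabulate {n = zero}  F = refl
length-concat-tabulate {n = suc n} F =
  trans (length-++ (F zero)) (cong (length (F zero) +_) (length-concat-tabulate (λ i → F (suc i))))

length-words : ∀ Q w → length (words Q w) ≡ Q ^ w
length-words Q zero    = refl
length-words Q (suc w) = trans
  (length-concat-tabulate {n = Q} (λ b → map (b Vector.∷_) (words Q w)))
  (∑-const {Q} _ (Q ^ w) (λ b → trans (length-map (b Vector.∷_) (words Q w)) (length-words Q w)))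

-- The sum of Q ^ agree c x over all words x factors over the coordinates, each
-- of which contributes 2Q − 1; Markov's inequality then bounds the ball sizes.
weight : ∀ {Q w} → Word Q w → Word Q w → ℕ
weight {Q} c x = Q ^ agree c x

sum-weight-∷ : ∀ {Q w} (c : Word Q (suc w)) b xs →
               sum (map (weight c) (map (b Vector.∷_) xs)) ≡
               Q ^ match (c zero) b * sum (map (weight (λ i → c (suc i))) xs)
sum-weight-∷ {Q} c b []       = sym (*-zeroʳ (Q ^ match (c zero) b))
sum-weight-∷ {Q} c b (x ∷ xs)
  rewrite sum-weight-∷ c b xs
        | ^-distribˡ-+-* Q (match (c zero) b) (agree (λ i → c (suc i)) x)
        = sym (*-distribˡ-+ (Q ^ match (c zero) b) _ _)

-- One letter contributes `A` and each of the other n - 1 contributes 1. The sum is rounded up by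
-- one, so that for `A` = n = `Q` the factor per coordinate is `2 * Q`.
∑-match : ∀ A {n} (c : Fin n) → ∑ (λ b → A ^ match c b) ≤ A + n
∑-match A {suc n} zero    = +-mono-≤ (≤-reflexive (*-identityʳ A))
  (≤-trans (≤-reflexive (trans (∑-const {n} _ 1 (λ _ → refl)) (*-identityʳ n))) (n≤1+n n))
∑-match A {suc n} (suc c) = begin
  1 + ∑ (λ b → A ^ match (suc c) (suc b)) ≤⟨ s≤s (∑-match A c) ⟩
  1 + (A + n)                             ≡⟨ +-suc A n ⟨
  A + suc n                               ∎
  where open ≤-Reasoning

sum-weight : ∀ {Q} w (c : Word Q w) → sum (map (weight c) (words Q w)) ≤ (2 * Q) ^ w
sum-weight     zero    c = ≤-refl
sum-weight {Q} (suc w) c = begin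
  sum (map (weight c) (words Q (suc w)))
    ≡⟨ sum-map-concat-tabulate (weight c) (λ b → map (b Vector.∷_) (words Q w)) ⟩
  ∑ (λ b → sum (map (weight c) (map (b Vector.∷_) (words Q w))))
    ≡⟨ ∑-cong (λ b → sum-weight-∷ c b (words Q w)) ⟩
  ∑ (λ b → Q ^ match (c zero) b * S)
    ≡⟨ ∑-*ʳ (λ b → Q ^ match (c zero) b) S ⟩
  ∑ (λ b → Q ^ match (c zero) b) * S
    ≤⟨ *-mono-≤ (∑-match Q (c zero)) (sum-weight w (λ i → c (suc i))) ⟩
  (Q + Q) * (2 * Q) ^ w
    ≡⟨ cong (λ a → (Q + a) * (2 * Q) ^ w) (+-identityʳ Q) ⟨
  (2 * Q) ^ suc w
    ∎
  where
  open ≤-Reasoning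
  S = sum (map (weight (λ i → c (suc i))) (words Q w))

markov : ∀ {A : Set} {P : Pred A 0ℓ} (P? : Decidable P) (f : A → ℕ) s →
         (∀ x → P x → s ≤ f x) → ∀ xs → length (filter P? xs) * s ≤ sum (map f xs)
markov P? f s le []       = z≤n
markov P? f s le (x ∷ xs) with P? x
... | yes p = +-mono-≤ (le x p) (markov P? f s le xs)
... | no  _ = ≤-trans (markov P? f s le xs) (m≤n+m _ _)

^-distribʳ-* : ∀ o m n → (m * n) ^ o ≡ m ^ o * n ^ o
^-distribʳ-* zero    m n = refl
^-distribʳ-* (suc o) m n rewrite ^-distribʳ-* o m n = interchange m n (m ^ o) (n ^ o)
  where
  interchange : ∀ a b c d → (a * b) * (c * d) ≡ (a * c) * (b * d)
  interchange = solve-∀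

-- With w = m + g, a ball has at most (2Q)^w / Q^g = 2^w Q^m words. Removing 2^w of them from the
-- Q^w words is affordable as soon as 4^w Q^m ≤ Q^w, which is the hypothesis multiplied by Q^m.
gilbert-varshamov : ∀ Q .{{_ : NonZero Q}} m g → 4 ^ (m + g) ≤ Q ^ g →
                    Σ (Fin (2 ^ (m + g)) → Word Q (m + g)) λ f →
                      ∀ i j → i ≢ j → agree (f i) (f j) < g
gilbert-varshamov Q m g large
  = let f , _ , apart = greedy-code g B B>0 (2 ^ w) (words Q w) enough balls in f , apart
  where
  w = m + g
  B = 2 ^ w * Q ^ m
  B>0 : 0 < B
  B>0 = *-mono-≤ (m^n>0 2 w) (m^n>0 Q m)
  open ≤-Reasoning
  enough : 2 ^ w * B ≤ length (words Q w)
  enough = begin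
    2 ^ w * (2 ^ w * Q ^ m) ≡⟨ *-assoc (2 ^ w) (2 ^ w) (Q ^ m) ⟨
    2 ^ w * 2 ^ w * Q ^ m   ≡⟨ cong (_* Q ^ m) (^-distribʳ-* w 2 2) ⟨
    4 ^ w * Q ^ m           ≤⟨ *-monoˡ-≤ (Q ^ m) large ⟩
    Q ^ g * Q ^ m           ≡⟨ *-comm (Q ^ g) (Q ^ m) ⟩
    Q ^ m * Q ^ g           ≡⟨ ^-distribˡ-+-* Q m g ⟨
    Q ^ w                   ≡⟨ length-words Q w ⟨
    length (words Q w)      ∎
  balls : ∀ c → length (filter (near? g c) (words Q w)) ≤ B
  balls c = *-cancelʳ-≤ _ _ (Q ^ g) {{m^n≢0 Q g}} (begin
    length (filter (near? g c) (words Q w)) * Q ^ g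
      ≤⟨ markov (near? g c) (weight c) (Q ^ g) (λ _ → ^-monoʳ-≤ Q) (words Q w) ⟩
    sum (map (weight c) (words Q w))                ≤⟨ sum-weight w c ⟩
    (2 * Q) ^ w                                     ≡⟨ ^-distribʳ-* w 2 Q ⟩
    2 ^ w * Q ^ w                                   ≡⟨ cong (2 ^ w *_) (^-distribˡ-+-* Q m g) ⟩
    2 ^ w * (Q ^ m * Q ^ g)                         ≡⟨ *-assoc (2 ^ w) (Q ^ m) (Q ^ g) ⟨
    B * Q ^ g                                       ∎)

-- Graphs with a pair of matchings for each index

module Graph {N K D : ℕ} (src tgt : Fin K → Fin 2 → Fin D → Fin N)
  (src-injective : ∀ c {κ κ′ i i′} → src c κ i ≡ src c κ′ i′ → κ ≡ κ′ × i ≡ i′)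
  (tgt-injective : ∀ c {κ κ′ i i′} → tgt c κ i ≡ tgt c κ′ i′ → κ ≡ κ′ × i ≡ i′)
  (no-cross : ∀ c d κ κ′ i j i′ → src c κ i ≡ src d κ′ i′ → tgt c κ j ≡ tgt d κ′ i′ → c ≡ d)
  where

  edge : Fin K → Fin 2 → Fin D → Edge N
  edge c κ i = src c κ i , tgt c κ i

  M : Fin K × Fin 2 → List (Edge N)
  M (c , κ) = tabulate (edge c κ)

  -- The union of the two matchings of `c`, tabulated over `Fin (2 * D)` so that its length is
  -- immediate.
  P : Fin K → List (Edge N)
  P c = tabulate (λ k → edge c (proj₁ (remQuot {2} D k)) (proj₂ (remQuot {2} D k)))

  M# : Fin (K * 2) → List (Edge N)
  M# k = M (remQuot 2 k)

  open DecMembership (Product.≡-dec (Fin._≟_ {N}) (Fin._≟_ {N})) using (_∈?_)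

  edge? : (e : Edge N) → Dec (∃ λ k → e ∈ M# k)
  edge? e = Fin.any? (λ k → e ∈? M# k)

  E : BipGraph N
  E a b = does (edge? (a , b))

  edge⁺ : ∀ {e} cκ → e ∈ M cκ → IsEdge E e
  edge⁺ {e} cκ@(c , κ) p = dec-true (edge? e)
    (combine c κ , subst (λ v → e ∈ M v) (sym (Fin.remQuot-combine c κ)) p)

  edge⁻ : ∀ {e} → IsEdge E e → ∃ λ k → e ∈ M# k
  edge⁻ {e} p with edge? e
  ... | yes q = q
  edge⁻ {e} () | no _

  -- Sources and targets are injective jointly in `κ` and the index, so this serves both a single
  -- matching and the union `P c`.
  edges-meet : ∀ c {κ κ′ i i′} →
               src c κ i ≡ src c κ′ i′ ⊎ tgt c κ i ≡ tgt c κ′ i′ → edge c κ i ≡ edge c κ′ i′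
  edges-meet c (inj₁ p) with refl , refl ← src-injective c p = refl
  edges-meet c (inj₂ p) with refl , refl ← tgt-injective c p = refl

  -- The common source of inducedness and disjointness. Applied to two edges of a matching and an
  -- edge of the graph between them, it puts that edge into the same matching; applied with all
  -- three edges equal, it says that an edge lies in one matching only.
  M-unique-index : ∀ {cκ dκ a b b′ a′} → (a , b′) ∈ M cκ → (a′ , b) ∈ M cκ → (a , b) ∈ M dκ →
                   cκ ≡ dκ
  M-unique-index {c , κ} {d , κ′} p p′ q
    with i , refl ← ∈-tabulate⁻ p | j , refl ← ∈-tabulate⁻ p′ | i′ , eq ← ∈-tabulate⁻ q
    with refl ← no-cross c d κ κ′ i j i′ (cong proj₁ eq) (cong proj₂ eq)
    -- Once the code words coincide, the shared source forces the same half `κ`.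
    with refl , _ ← src-injective c (cong proj₁ eq) = refl

  M-isMatching : ∀ cκ → IsMatching E (M cκ)
  M-isMatching (c , κ) =
    Unique.tabulate⁺ (λ p → proj₂ (src-injective c (cong proj₁ p))) ,
    All.tabulate⁺ (λ i → edge⁺ (c , κ) (∈-tabulate⁺ i)) ,
    meet
    where
    meet : ∀ e e′ → e ∈ M (c , κ) → e′ ∈ M (c , κ) →
           proj₁ e ≡ proj₁ e′ ⊎ proj₂ e ≡ proj₂ e′ → e ≡ e′
    meet e e′ p p′ with i , refl ← ∈-tabulate⁻ p | i′ , refl ← ∈-tabulate⁻ p′ = edges-meet c

  M-isInduced : ∀ cκ → IsInduced E (M cκ)
  M-isInduced cκ e e′ p p′ q with k , r ← edge⁻ q =
    subst (λ v → _ ∈ M v) (sym (M-unique-index p p′ r)) r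

  isRS : IsRS E D (K * 2)
  isRS = M# ,
    (λ k → M-isMatching _ , M-isInduced _ , ≤-reflexive (sym (length-tabulate _))) ,
    λ e p → let k , q = edge⁻ p in
      k , q , λ j r → remQuot-injective {K} 2 (M-unique-index r r q)

  P⊆M : ∀ c {e} → e ∈ P c → ∃ λ κ → e ∈ M (c , κ)
  P⊆M c p with k , refl ← ∈-tabulate⁻ p = _ , ∈-tabulate⁺ (proj₂ (remQuot {2} D k))

  P-isMatching : ∀ c → IsMatching E (P c)
  P-isMatching c =
    Unique.tabulate⁺ (λ p → let q , r = src-injective c (cong proj₁ p) in
      remQuot-injective {2} D (cong₂ _,_ q r)) ,
    All.tabulate⁺ (λ k → edge⁺ (c , proj₁ (remQuot {2} D k)) (∈-tabulate⁺ _)) ,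
    meet
    where
    meet : ∀ e e′ → e ∈ P c → e′ ∈ P c →
           proj₁ e ≡ proj₁ e′ ⊎ proj₂ e ≡ proj₂ e′ → e ≡ e′
    meet e e′ p p′ with k , refl ← ∈-tabulate⁻ p | k′ , refl ← ∈-tabulate⁻ p′ = edges-meet c

  length-P : ∀ c → length (P c) ≡ 2 * D
  length-P c = length-tabulate _

  P-disjoint : ∀ c d → c ≢ d → ∀ e → e ∈ P c → e ∈ P d → ⊥
  P-disjoint c d c≢d e p q with κ , p′ ← P⊆M c p | κ′ , q′ ← P⊆M d q =
    c≢d (cong proj₁ (M-unique-index p′ p′ q′))

-- Levels and pushes

-- The conclusion for δ = p / q with denominators cleared: the inequality is r ≥ (1/2 - δ) N, and
-- the equation on lengths is |P i| = (1 - 2δ) N.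
NearPerfectRS : ℕ → ℕ → ℕ → ℕ → ℕ → Set
NearPerfectRS p q cp cq N₀ =
  Σ ℕ λ N → N₀ ≤ N ×
  Σ (BipGraph N) λ E → Σ ℕ λ r → Σ ℕ λ t →
  (q * N ≤ 2 * q * r + 2 * p * N) ×
  IsRS E r t ×
  AtLeastPow cp cq N t ×
  Σ ℕ λ k → Σ (Fin k → List (Edge N)) λ P →
  AtLeastPow cp cq N k ×
  ((i : Fin k) → IsMatching E (P i) ×
  (length (P i) * q + 2 * p * N ≡ q * N)) ×
  ((i j : Fin k) → i ≢ j → (e : Edge N) → e ∈ P i → e ∈ P j → ⊥)

module Levels {Q w m g K : ℕ} .{{_ : NonZero w}} (w≡m+g : w ≡ m + g)
  (code : Fin K → Word Q w)
  (apart : ∀ c d → c ≢ d → agree (code c) (code d) < g)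
  where

  L X N : ℕ
  L = 2 * w
  X = L ^ (w * Q)
  N = L * X

  instance
    L≢0 : NonZero L
    L≢0 = m*n≢0 2 w

  open Modular L

  -- An element of `Fin X` codes a point of (ℤ/L)^(w × Q), whose coordinate (i , a) sits at index
  -- `combine i a`. Points are codes rather than functions, so pointwise agreement yields equality.
  coord : Fin X → Fin (w * Q) → Fin L
  coord = finToFun {L} {w * Q}

  increment : Fin K → Fin w × Fin Q → ℕ
  increment d (i , a) = match a (code d i)

  shift : Fin K → Fin X → Fin X
  shift d x = funToFin λ k → bump (increment d (remQuot {w} Q k)) (coord x k)

  coord-shift : ∀ d x i a → toℕ (coord (shift d x) (combine i a)) % L ≡
                   (toℕ (coord x (combine i a)) + match a (code d i)) % L
  coord-shift d x i a = begin
    toℕ (coord (shift d x) (combine i a)) % L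
      ≡⟨ cong (λ y → toℕ y % L) (Fin.finToFun-funToFin _ (combine i a)) ⟩
    toℕ (bump (increment d (remQuot {w} Q (combine i a))) (coord x (combine i a))) % L
      ≡⟨ toℕ-mod-% (toℕ (coord x (combine i a)) + increment d (remQuot {w} Q (combine i a))) ⟩
    (toℕ (coord x (combine i a)) + increment d (remQuot {w} Q (combine i a))) % L
      ≡⟨ cong (λ ia → (toℕ (coord x (combine i a)) + increment d ia) % L) (Fin.remQuot-combine {w} {Q} i a) ⟩
    (toℕ (coord x (combine i a)) + match a (code d i)) % L
      ∎
    where open ≡-Reasoning

  shift-injective : ∀ d {x y} → shift d x ≡ shift d y → x ≡ y
  shift-injective d {x} {y} p = begin
    x                                    ≡⟨ Fin.funToFin-finToFin {w * Q} {L} x ⟨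
    funToFin (coord x)    ≡⟨ funToFin-cong (λ k → bump-injective _ (pointwise k)) ⟩
    funToFin (coord y)    ≡⟨ Fin.funToFin-finToFin {w * Q} {L} y ⟩
    y                                    ∎
    where
    open ≡-Reasoning
    pointwise : ∀ k → _
    pointwise k = trans (sym (Fin.finToFun-funToFin _ k))
      (trans (cong (λ v → coord v k) p) (Fin.finToFun-funToFin _ k))

  height : Fin K → Fin X → ℕ
  height c x = ∑ λ i → toℕ (coord x (combine i (code c i)))

  -- Among the coordinates (i , c i) that `c` reads, the push along `d` raises by one exactly those
  -- with c i = d i.
  height-shift : ∀ c d x → height c (shift d x) % L ≡ (height c x + agree (code c) (code d)) % L
  height-shift c d x = trans
    (∑-cong-% _ _ (λ i → coord-shift d x i (code c i)))
    (cong (_% L) (∑-+ _ (λ i → match (code c i) (code d i))))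

  level : Fin K → Fin N → ℕ
  level c v = (toℕ (proj₁ (remQuot {L} X v)) + height c (proj₂ (remQuot {L} X v))) % L

  level-combine : ∀ c z x → level c (combine z x) ≡ (toℕ z + height c x) % L
  level-combine c z x = cong (λ v → (toℕ (proj₁ v) + height c (proj₂ v)) % L) (Fin.remQuot-combine z x)

  push : Fin K → Fin N → Fin N
  push d v = combine (proj₁ (remQuot {L} X v)) (shift d (proj₂ (remQuot {L} X v)))

  push-injective : ∀ d {u v} → push d u ≡ push d v → u ≡ v
  push-injective d p with q , r ← Fin.combine-injective {L} {X} _ _ _ _ p =
    remQuot-injective {L} X (cong₂ _,_ q (shift-injective d r))

  level-push : ∀ c d v → level c (push d v) ≡ (level c v + agree (code c) (code d)) % L
  level-push c d v = begin
    level c (push d v)                ≡⟨ level-combine c z (shift d x) ⟩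
    (toℕ z + height c (shift d x)) % L ≡⟨ %-cong-+ {a = toℕ z} refl (height-shift c d x) ⟩
    (toℕ z + (height c x + s)) % L    ≡⟨ cong (_% L) (+-assoc (toℕ z) (height c x) s) ⟨
    (toℕ z + height c x + s) % L      ≡⟨ %-cong-+ {b = s} (sym (m%n%n≡m%n (toℕ z + height c x) L)) refl ⟩
    (level c v + s) % L               ∎
    where
    open ≡-Reasoning
    z = proj₁ (remQuot {L} X v)
    x = proj₂ (remQuot {L} X v)
    s = agree (code c) (code d)

  -- The solution z of z + height c x = a, paired with `x`. Hence the level `a` and the point `x`
  -- can be prescribed independently, which is the equidistribution of levels.
  start : Fin K → Fin L → Fin X → Fin N
  start c a x = combine ((toℕ a + height c x * pred L) mod L) x

  level-start : ∀ c a x → level c (start c a x) ≡ toℕ a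
  level-start c a x = begin
    level c (start c a x)                         ≡⟨ level-combine c _ x ⟩
    (toℕ ((toℕ a + h * pred L) mod L) + h) % L    ≡⟨ %-cong-+ {b = h} (toℕ-mod-% (toℕ a + h * pred L)) refl ⟩
    (toℕ a + h * pred L + h) % L                  ≡⟨ cong (_% L) (+-assoc (toℕ a) _ h) ⟩
    (toℕ a + (h * pred L + h)) % L                ≡⟨ cong (λ y → (toℕ a + y) % L) (+-comm _ h) ⟩
    (toℕ a + (h + h * pred L)) % L                ≡⟨ %-+-inverse (toℕ a) h ⟩
    toℕ a % L                                     ≡⟨ toℕ-% a ⟩
    toℕ a                                         ∎
    where
    open ≡-Reasoning
    h = height c x

  start-injective : ∀ c {a b x y} → start c a x ≡ start c b y → a ≡ b × x ≡ y
  start-injective c {a} {b} {x} {y} p =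
    Fin.toℕ-injective (trans (sym (level-start c a x)) (trans (cong (level c) p) (level-start c b y))) ,
    Fin.combine-injectiveʳ {L} {X} _ x _ y p

  -- The two matchings of a code word

  D : ℕ
  D = m * X

  m≤w : m ≤ w
  m≤w = subst (m ≤_) (sym w≡m+g) (m≤m+n m g)

  offset : Fin D → Fin m
  offset i = proj₁ (remQuot {m} X i)

  -- As L = 2w, `combine κ` lands in the half of ℤ/L that starts at κ w; only the first m = w - g
  -- levels of that half occur.
  interval : Fin 2 → Fin m → Fin L
  interval κ b = combine κ (inject≤ b m≤w)

  toℕ-interval : ∀ κ b → toℕ (interval κ b) ≡ toℕ b + w * toℕ κ
  toℕ-interval κ b = begin
    toℕ (interval κ b)                      ≡⟨ Fin.toℕ-combine κ (inject≤ b m≤w) ⟩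
    w * toℕ κ + toℕ (inject≤ b m≤w)         ≡⟨ cong (w * toℕ κ +_) (Fin.toℕ-inject≤ b m≤w) ⟩
    w * toℕ κ + toℕ b                       ≡⟨ +-comm (w * toℕ κ) (toℕ b) ⟩
    toℕ b + w * toℕ κ                       ∎
    where open ≡-Reasoning

  src tgt : Fin K → Fin 2 → Fin D → Fin N
  src c κ i = start c (interval κ (offset i)) (proj₂ (remQuot {m} X i))
  tgt c κ i = push c (src c κ i)

  level-src : ∀ c κ i → level c (src c κ i) ≡ toℕ (offset i) + w * toℕ κ
  level-src c κ i = trans (level-start c _ _) (toℕ-interval κ (offset i))

  src-injective : ∀ c {κ κ′ i i′} → src c κ i ≡ src c κ′ i′ → κ ≡ κ′ × i ≡ i′
  src-injective c {κ} {κ′} p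
    with q , r ← start-injective c p
    with κ≡ , b≡ ← Fin.combine-injective κ _ κ′ _ q =
    κ≡ , remQuot-injective {m} X (cong₂ _,_ (Fin.inject≤-injective m≤w m≤w _ _ b≡) r)

  tgt-injective : ∀ c {κ κ′ i i′} → tgt c κ i ≡ tgt c κ′ i′ → κ ≡ κ′ × i ≡ i′
  tgt-injective c p = src-injective c (push-injective c p)

  -- Suppose c ≠ d and compute the c-level of the shared target twice. As the end of edge `j` of `c`
  -- it is b′ + κ w + w; as the push along `d` of the source of edge `i` it is b + κ w + s, where s
  -- < g. Cancelling κ w leaves b′ + w and b + s congruent modulo L. Both are below L, hence equal,
  -- yet b + s < m + g = w.
  no-cross : ∀ c d κ κ′ i j i′ → src c κ i ≡ src d κ′ i′ → tgt c κ j ≡ tgt d κ′ i′ → c ≡ d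
  no-cross c d κ κ′ i j i′ p q with c Fin.≟ d
  ... | yes c≡d = c≡d
  ... | no  c≢d = contradiction (sym offsets) (<⇒≢ (<-≤-trans b+s<w (m≤n+m w b′)))
    where
    b  = toℕ (offset i)
    b′ = toℕ (offset j)
    s  = agree (code c) (code d)
    b+s<w : b + s < w
    b+s<w = subst (b + s <_) (sym w≡m+g) (+-mono-< (Fin.toℕ<n (offset i)) (apart c d c≢d))
    w<L : ∀ {a} → a < w → a + w < L
    w<L {a} a<w = subst (λ y → a + w < w + y) (sym (+-identityʳ w)) (+-monoˡ-< w a<w)
    levels : (b′ + w * toℕ κ + w) % L ≡ (b + w * toℕ κ + s) % L
    levels = begin
      (b′ + w * toℕ κ + w) % L  ≡⟨ cong₂ (λ x y → (x + y) % L) (level-src c κ j) (agree-refl (code c)) ⟨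
      (level c (src c κ j) + agree (code c) (code c)) % L ≡⟨ level-push c c (src c κ j) ⟨
      level c (tgt c κ j)       ≡⟨ cong (level c) q ⟩
      level c (push d (src d κ′ i′)) ≡⟨ cong (λ v → level c (push d v)) p ⟨
      level c (push d (src c κ i)) ≡⟨ level-push c d (src c κ i) ⟩
      (level c (src c κ i) + s) % L ≡⟨ cong (λ x → (x + s) % L) (level-src c κ i) ⟩
      (b + w * toℕ κ + s) % L   ∎
      where open ≡-Reasoning
    swap : ∀ x y z → x + y + z ≡ x + z + y
    swap = solve-∀
    offsets : b′ + w ≡ b + s
    offsets = begin
      b′ + w       ≡⟨ m<n⇒m%n≡m (w<L (<-≤-trans (Fin.toℕ<n (offset j)) m≤w)) ⟨
      (b′ + w) % L ≡⟨ %-cancelʳ-+ (b′ + w) (b + s) (w * toℕ κ)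
                        (subst₂ (λ x y → x % L ≡ y % L) (swap b′ _ w) (swap b _ s) levels) ⟩
      (b + s) % L  ≡⟨ m<n⇒m%n≡m (<-≤-trans b+s<w (m≤m+n w _)) ⟩
      b + s        ∎
      where open ≡-Reasoning

  open Graph src tgt src-injective tgt-injective no-cross

  nearPerfectRS : ∀ p q cp cq N₀ → N₀ ≤ w → m * q + 2 * p * w ≡ q * w →
                  AtLeastPow cp cq N K → NearPerfectRS p q cp cq N₀
  nearPerfectRS p q cp cq N₀ N₀≤w balance N-small =
    N , ≤-trans N₀≤w w≤N , E , D , K * 2 ,
    -- The bound on r = `D` holds with equality, since `P c` consists of two matchings of size `D`.
    ≤-reflexive (trans (sym total) (cong (_+ 2 * p * N) (reorder D q))) ,
    isRS ,
    ≤-trans N-small (^-monoˡ-≤ (cq * loglog N) (m≤m*n K 2)) ,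
    K , P , N-small ,
    (λ c → P-isMatching c , trans (cong (λ l → l * q + 2 * p * N) (length-P c)) total) ,
    P-disjoint
    where
    w≤N : w ≤ N
    w≤N = ≤-trans (m≤n*m w 2) (m≤m*n L X {{m^n≢0 L (w * Q)}})
    reorder : ∀ D q → 2 * D * q ≡ 2 * q * D
    reorder = solve-∀
    -- This is `balance`, that is m / w = 1 - 2p / q, scaled by 2X.
    total : 2 * D * q + 2 * p * N ≡ q * N
    total = begin
      2 * (m * X) * q + 2 * p * (2 * w * X) ≡⟨ factor m p q w X ⟩
      (m * q + 2 * p * w) * (2 * X)         ≡⟨ cong (_* (2 * X)) balance ⟩
      q * w * (2 * X)                       ≡⟨ unfactor q w X ⟩
      q * (2 * w * X)                       ∎
      where
      open ≡-Reasoning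
      factor : ∀ m p q w X →
               2 * (m * X) * q + 2 * p * (2 * w * X) ≡ (m * q + 2 * p * w) * (2 * X)
      factor = solve-∀
      unfactor : ∀ q w X → q * w * (2 * X) ≡ q * (2 * w * X)
      unfactor = solve-∀

-- The size of N

n<2^[1+⌊log₂n⌋] : ∀ n → n < 2 ^ suc ⌊log₂ n ⌋
n<2^[1+⌊log₂n⌋] n with n <? 2 ^ suc ⌊log₂ n ⌋
... | yes p = p
... | no ¬p = contradiction
  (subst (_≤ ⌊log₂ n ⌋) (⌊log₂[2^n]⌋≡n (suc ⌊log₂ n ⌋)) (⌊log₂⌋-mono-≤ (≮⇒≥ ¬p)))
  1+n≰n

-- Base 4 absorbs the rounding of the logarithm: for n ≥ 2 the logarithm ℓ is at least 1, so 1 + ℓ ≤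
-- 2ℓ.
n≤4^⌊log₂n⌋ : ∀ n → 2 ≤ n → n ≤ 4 ^ ⌊log₂ n ⌋
n≤4^⌊log₂n⌋ n 2≤n = begin
  n                   ≤⟨ <⇒≤ (n<2^[1+⌊log₂n⌋] n) ⟩
  2 ^ suc ℓ           ≤⟨ *-monoˡ-≤ (2 ^ ℓ) (^-monoʳ-≤ 2 1≤ℓ) ⟩
  2 ^ ℓ * 2 ^ ℓ       ≡⟨ ^-distribʳ-* ℓ 2 2 ⟨
  4 ^ ℓ               ∎
  where
  open ≤-Reasoning
  ℓ = ⌊log₂ n ⌋
  1≤ℓ : 1 ≤ ℓ
  1≤ℓ = ⌊log₂⌋-mono-≤ 2≤n

-- N is (2w)^(1 + wQ), which is at most (2w)^(2wQ). Moreover log N ≥ 1 + wQ ≥ 2w, so 2w ≤ 4^ℓ with ℓ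
-- = `loglog N`. Together N ≤ 2^(4wQℓ); one factor 2 of the constant pays for 1 + wQ ≤ 2wQ, the
-- other for base 4.
loglog-bound : ∀ w Q → 1 ≤ w → 2 ≤ Q →
               AtLeastPow 1 (4 * Q) (2 * w * (2 * w) ^ (w * Q)) (2 ^ w)
loglog-bound w Q 1≤w 2≤Q = begin
  N ^ 1                     ≡⟨ *-identityʳ N ⟩
  (2 * w) ^ suc (w * Q)     ≤⟨ ^-monoʳ-≤ (2 * w) 1+wQ≤wQ+wQ ⟩
  (2 * w) ^ (w * Q + w * Q) ≤⟨ ^-monoˡ-≤ (w * Q + w * Q) 2w≤4^ℓ ⟩
  (4 ^ ℓ) ^ (w * Q + w * Q) ≡⟨ cong (_^ (w * Q + w * Q)) (^-*-assoc 2 2 ℓ) ⟩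
  (2 ^ (2 * ℓ)) ^ (w * Q + w * Q) ≡⟨ ^-*-assoc 2 (2 * ℓ) _ ⟩
  2 ^ (2 * ℓ * (w * Q + w * Q)) ≡⟨ cong (2 ^_) (exponent ℓ w Q) ⟩
  2 ^ (w * (4 * Q * ℓ))     ≡⟨ ^-*-assoc 2 w _ ⟨
  (2 ^ w) ^ (4 * Q * ℓ)     ∎
  where
  open ≤-Reasoning
  N = 2 * w * (2 * w) ^ (w * Q)
  ℓ = loglog N
  2≤2w : 2 ≤ 2 * w
  2≤2w = *-monoʳ-≤ 2 1≤w
  instance
    2w≢0 : NonZero (2 * w)
    2w≢0 = >-nonZero (≤-trans (s≤s z≤n) 2≤2w)
  1+wQ≤wQ+wQ : suc (w * Q) ≤ w * Q + w * Q
  1+wQ≤wQ+wQ = +-monoˡ-≤ (w * Q) (*-mono-≤ 1≤w (≤-trans (s≤s z≤n) 2≤Q))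
  2w≤log : 2 * w ≤ ⌊log₂ N ⌋
  2w≤log = begin
    2 * w                  ≡⟨ *-comm 2 w ⟩
    w * 2                  ≤⟨ *-monoʳ-≤ w 2≤Q ⟩
    w * Q                  ≤⟨ n≤1+n _ ⟩
    suc (w * Q)            ≡⟨ ⌊log₂[2^n]⌋≡n (suc (w * Q)) ⟨
    ⌊log₂ 2 ^ suc (w * Q) ⌋ ≤⟨ ⌊log₂⌋-mono-≤ (^-monoˡ-≤ (suc (w * Q)) 2≤2w) ⟩
    ⌊log₂ N ⌋              ∎
  2w≤4^ℓ : 2 * w ≤ 4 ^ ℓ
  2w≤4^ℓ = ≤-trans (n≤4^⌊log₂n⌋ (2 * w) 2≤2w) (^-monoʳ-≤ 4 (⌊log₂⌋-mono-≤ 2w≤log))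
  exponent : ∀ ℓ w Q → 2 * ℓ * (w * Q + w * Q) ≡ w * (4 * Q * ℓ)
  exponent = solve-∀

-- Choice of parameters

construct : ∀ p q N₀ → 0 < p → 0 < q → 2 * p ≤ q → NearPerfectRS p q 1 (4 * 4 ^ q) N₀
construct p q N₀ p>0 q>0 2p≤q =
  Levels.nearPerfectRS {m = m} {g = g} refl (proj₁ code) (proj₂ code) p q 1 (4 * 4 ^ q) N₀
    (≤-trans (n≤1+n N₀) j≤w) balance
    (loglog-bound w (4 ^ q) (≤-trans (s≤s z≤n) j≤w)
      (≤-trans (s≤s (s≤s z≤n)) (^-monoʳ-≤ 4 q>0)))
  where
  d j m g w : ℕ
  -- The ratio g / w = 2p / q is exact: w = q j, g = 2p j and m = (q - 2p) j. Only the scale j = N₀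
  -- + 1 depends on `N₀`, while Q = 4^q does not, so the exponent in the final bounds is uniform in
  -- `N₀`.
  d = q ∸ 2 * p
  j = suc N₀
  m = d * j
  g = 2 * p * j
  w = m + g
  instance
    Q≢0 : NonZero (4 ^ q)
    Q≢0 = m^n≢0 4 q
  q≡d+2p : q ≡ d + 2 * p
  q≡d+2p = sym (m∸n+n≡m 2p≤q)
  w≡qj : w ≡ q * j
  w≡qj = trans (sym (*-distribʳ-+ j d (2 * p))) (cong (_* j) (sym q≡d+2p))
  j≤w : j ≤ w
  j≤w = subst (j ≤_) (sym w≡qj) (m≤n*m j q {{>-nonZero q>0}})
  instance
    w≢0 : NonZero w
    w≢0 = >-nonZero (≤-trans (s≤s z≤n) j≤w)
  j≤g : j ≤ g
  j≤g = m≤n*m j (2 * p) {{>-nonZero (*-mono-≤ {1} {2} (s≤s z≤n) p>0)}}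
  -- The reason for Q = 4^q: w = q j and j ≤ g, hence w ≤ q g.
  large : 4 ^ w ≤ (4 ^ q) ^ g
  large = begin
    4 ^ w       ≡⟨ cong (4 ^_) w≡qj ⟩
    4 ^ (q * j) ≤⟨ ^-monoʳ-≤ 4 (*-monoʳ-≤ q j≤g) ⟩
    4 ^ (q * g) ≡⟨ ^-*-assoc 4 q g ⟨
    (4 ^ q) ^ g ∎
    where open ≤-Reasoning
  code : Σ (Fin (2 ^ w) → Word (4 ^ q) w) λ f → ∀ c d → c ≢ d → agree (f c) (f d) < g
  code = gilbert-varshamov (4 ^ q) m g large
  balance : m * q + 2 * p * w ≡ q * w
  balance = begin
    d * j * q + 2 * p * w         ≡⟨ cong (λ v → d * j * q + 2 * p * v) w≡qj ⟩
    d * j * q + 2 * p * (q * j)   ≡⟨ factor d j q p ⟩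
    (d + 2 * p) * (q * j)         ≡⟨ cong₂ _*_ (sym q≡d+2p) (sym w≡qj) ⟩
    q * w                         ∎
    where
    open ≡-Reasoning
    factor : ∀ d j q p → d * j * q + 2 * p * (q * j) ≡ (d + 2 * p) * (q * j)
    factor = solve-∀

theorem4 : Σ ℕ λ d₀ → Σ ℕ λ e₀ → 0 < d₀ × 0 < e₀ ×
    ((p q : ℕ) → 0 < p → 0 < q → p * e₀ < d₀ * q →
    Σ ℕ λ cp → Σ ℕ λ cq → 0 < cp × 0 < cq ×
    ((N₀ : ℕ) → Σ ℕ λ N → N₀ ≤ N ×
    Σ (BipGraph N) λ E → Σ ℕ λ r → Σ ℕ λ t →
    (q * N ≤ 2 * q * r + 2 * p * N) ×
    IsRS E r t ×
    AtLeastPow cp cq N t ×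
    Σ ℕ λ k → Σ (Fin k → List (Edge N)) λ P →
    AtLeastPow cp cq N k ×
    ((i : Fin k) → IsMatching E (P i) ×
    (length (P i) * q + 2 * p * N ≡ q * N)) ×
    ((i j : Fin k) → i ≢ j → (e : Edge N) → e ∈ P i → e ∈ P j → ⊥)))
-- The threshold for δ is 1/2, which gives 2p ≤ q and so a difference q - 2p without truncation.
theorem4 = 1 , 2 , s≤s z≤n , s≤s z≤n , λ p q p>0 q>0 δ<½ →
  1 , 4 * 4 ^ q , s≤s z≤n , *-mono-≤ {1} {4} (s≤s z≤n) (m^n>0 4 q) , λ N₀ →
  construct p q N₀ p>0 q>0 (subst₂ _≤_ (*-comm p 2) (*-identityˡ q) (<⇒≤ δ<½))
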